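{- Let $\tau$ be a relational vocabulary whose relation symbols are at most binary. For every formula $\phi\in \mathsf{IF}^2(\tau)$ there is a formula $\phi^*\in \mathsf{D}^3(\tau)$ such that for all $\tau$-structures $\mathfrak{A}$ and all teams $X$ of $\mathfrak{A}$ with $\mathrm{dom}(X)=\{x,y\}$, $$\mathfrak{A}\models_X\phi \iff \mathfrak{A}\models_X\phi^*.$$
   Context: Syntax. Formulas of $\mathsf{IF}^2(\tau)$ (two-variable independence-friendly logic, with variables $x,y$) are generated by $\phi::= t_1=t_2\mid R(t_1,\dots,t_n)\mid \neg t_1=t_2\mid \neg R(t_1,\dots,t_n)\mid(\phi\wedge\phi)\mid(\phi\vee\phi)\mid\forall x\phi\mid\forall y\phi\mid\exists x/W\phi\mid\exists y/W\phi$, where $R\in\tau$ is $n$-ary, $t_1,\dots,t_n\in\{x,y\}$ and $W\subseteq\{x,y\}$; $\exists x/\emptyset\,\phi$ is identified with $\exists x\phi$. Formulas of $\mathsf{D}^3(\tau)$ (three-variable dependence logic) are the dependence logic formulas, in negation normal form, in which only the variables $x,y,z$ occur: they are built from first-order literals over $\tau$ (including equality literals), dependence atoms $=\!(t_1,\dots,t_n)$ and negated dependence atoms $\neg =\!(t_1,\dots,t_n)$ with terms in $\{x,y,z\}$, using $\wedge,\vee$ and the quantifiers $\forall v,\exists v$ with $v\in\{x,y,z\}$. Teams. A team $X$ of $\mathfrak{A}$ (domain $A$) with domain $\mathrm{dom}(X)=\{x_1,\dots,x_k\}$ is any set of assignments $\{x_1,\dots,x_k\}\to A$. The assignment $s(a/x)$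 has domain $\mathrm{dom}(s)\cup\{x\}$, maps $x$ to $a$ and agrees with $s$ elsewhere. For $F\colon X\to A$, $X(F/x)=\{s(F(s)/x)\mid s\in X\}$, and $X(A/x)=\{s(a/x)\mid s\in X,a\in A\}$. For $W\subseteq\mathrm{dom}(X)$, $F\colon X\to A$ is $W$-independent if $F(s)=F(s')$ whenever $s,s'\in X$ agree on $\mathrm{dom}(X)\setminus W$. Semantics (the domain of $X$ is assumed to contain the free variables of the formula). (1) For a first-order literal $\phi$: $\mathfrak{A}\models_X\phi$ iff every $s\in X$ satisfies $\phi$ in $\mathfrak{A}$ in the usual sense. (2) $\mathfrak{A}\models_X\psi\wedge\phi$ iff $\mathfrak{A}\models_X\psi$ and $\mathfrak{A}\models_X\phi$. (3) $\mathfrak{A}\models_X\psi\vee\phi$ iff $X=Y\cup Z$ for some teams $Y,Z$ with $\mathfrak{A}\models_Y\psi$ and $\mathfrak{A}\models_Z\phi$. (4) $\mathfrak{A}\models_X\exists v\psi$ iff $\mathfrak{A}\models_{X(F/v)}\psi$ for some $F\colon X\to A$. (5) $\mathfrak{A}\models_X\forall v\psi$ iff $\mathfrak{A}\models_{X(A/v)}\psi$. (6) $\mathfrak{A}\models_X\exists v/W\psi$ iff $\mathfrak{A}\models_{X(F/v)}\psi$ for some $W$-independent $F\colon X\to A$. (7) $\mathfrak{A}\models_X{=}(t_1,\dots,t_n)$ iff any $s,s'\in X$ that give equal values to each of $t_1,\dots,t_{n-1}$ give equal values to $t_n$. (8) $\mathfrak{A}\models_X\neg{=}(t_1,\dots,t_n)$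 iff $X=\emptyset$. -}

module Defs where

open import Data.Nat using (ℕ; _≤_)
open import Data.Fin using (Fin; zero; suc; _≟_)
open import Data.Fin.Subset using (Subset; inside; outside; _∈_; _∉_; _⊆_)
open import Data.Fin.Subset.Properties using (drop-there)
open import Data.List using (List)
import Data.List as List
import Data.List.Membership.Propositional as List∈
open import Data.Vec using (Vec; []; _∷_; _[_]≔_)
import Data.Vec as Vec
import Data.Vec.Membership.Propositional as Vec∈
open import Data.Vec.Relation.Unary.Any using (here; there)
open import Data.Vec.Properties using ([]≔-updates; []≔-minimal)
open import Data.Product using (Σ-syntax; ∃-syntax; _×_; _,_; proj₁; proj₂)
open import Data.Sum using (_⊎_; inj₁; inj₂)
open import Level using (Level; Lift) renaming (suc to lsuc)
open import Relation.Binary.PropositionalEquality using (_≡_; _≢_; refl)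
open import Relation.Nullary using (¬_; yes; no)
import Relation.Unary as U
open U using (Pred)

private variable
  n k : ℕ
  ℓ : Level

record Vocabulary : Set₁ where
  field
    Symbol : Set
    arity  : Symbol → ℕ

open Vocabulary public

AtMostBinary : Vocabulary → Set
AtMostBinary τ = ∀ (R : Symbol τ) → arity τ R ≤ 2

record Structure (τ : Vocabulary) (ℓ : Level) : Set (lsuc ℓ) where
  field
    Carrier : Set ℓ
    ⟦_⟧     : (R : Symbol τ) → Pred (Vec Carrier (arity τ R)) ℓ

open Structure public

------------------------------------------------------------------------
-- Syntax

-- Variable names are drawn from Fin n.  Formulas are indexed by the set
-- V of names that may occur in them at all (free, bound or slashed).
Name : Subset n → Set
Name V = ∃[ v ] v ∈ V

data Literal (τ : Vocabulary) (V : Subset n) : Set where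
  _≈_  : Name V → Name V → Literal τ V
  _≉_  : Name V → Name V → Literal τ V
  rel  : (R : Symbol τ) → Vec (Name V) (arity τ R) → Literal τ V
  ¬rel : (R : Symbol τ) → Vec (Name V) (arity τ R) → Literal τ V

data IF (τ : Vocabulary) (V : Subset n) : Set where
  lit       : Literal τ V → IF τ V
  _∧_ _∨_   : IF τ V → IF τ V → IF τ V
  all       : Name V → IF τ V → IF τ V
  ex_/⟨_,_⟩ : Name V → (W : Subset n) → W ⊆ V → IF τ V → IF τ V

-- dep (t₁ ∷ … ∷ tₘ₋₁ ∷ []) tₘ is the dependence atom =(t₁,…,tₘ).
data DL (τ : Vocabulary) (V : Subset n) : Set where
  lit      : Literal τ V → DL τ V
  dep ¬dep : List (Name V) → Name V → DL τ V
  _∧_ _∨_  : DL τ V → DL τ V → DL τ V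
  all ex   : Name V → DL τ V → DL τ V

-- x, y and z are the names 0, 1 and 2.
⟨x,y⟩ ⟨x,y,z⟩ : Subset 3
⟨x,y⟩   = inside ∷ inside ∷ outside ∷ []
⟨x,y,z⟩ = inside ∷ inside ∷ inside ∷ []

IF² D³ : Vocabulary → Set
IF² τ = IF τ ⟨x,y⟩
D³  τ = DL τ ⟨x,y,z⟩

------------------------------------------------------------------------
-- Free variables

FreeLit : {τ : Vocabulary} {V : Subset n} → Literal τ V → Pred (Fin n) _
FreeLit (t ≈ u)     v = v ≡ proj₁ t ⊎ v ≡ proj₁ u
FreeLit (t ≉ u)     v = v ≡ proj₁ t ⊎ v ≡ proj₁ u
FreeLit (rel R ts)  v = v Vec∈.∈ Vec.map proj₁ ts
FreeLit (¬rel R ts) v = v Vec∈.∈ Vec.map proj₁ ts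

-- Slashed variables count as free, since W-independence only makes sense
-- for W contained in the domain of the team.
FreeIF : {τ : Vocabulary} {V : Subset n} → IF τ V → Pred (Fin n) _
FreeIF (lit l)             v = FreeLit l v
FreeIF (φ ∧ ψ)             v = FreeIF φ v ⊎ FreeIF ψ v
FreeIF (φ ∨ ψ)             v = FreeIF φ v ⊎ FreeIF ψ v
FreeIF (all u φ)           v = v ≢ proj₁ u × FreeIF φ v
FreeIF (ex_/⟨_,_⟩ u W _ φ) v = v ∈ W ⊎ (v ≢ proj₁ u × FreeIF φ v)

FreeDL : {τ : Vocabulary} {V : Subset n} → DL τ V → Pred (Fin n) _
FreeDL (lit l)     v = FreeLit l v
FreeDL (dep ts t)  v = v List∈.∈ List.map proj₁ ts ⊎ v ≡ proj₁ t
FreeDL (¬dep ts t) v = v List∈.∈ List.map proj₁ ts ⊎ v ≡ proj₁ t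
FreeDL (φ ∧ ψ)     v = FreeDL φ v ⊎ FreeDL ψ v
FreeDL (φ ∨ ψ)     v = FreeDL φ v ⊎ FreeDL ψ v
FreeDL (all u φ)   v = v ≢ proj₁ u × FreeDL φ v
FreeDL (ex u φ)    v = v ≢ proj₁ u × FreeDL φ v

infix 4 _⊑_
_⊑_ : Pred (Fin n) Level.zero → Subset n → Set
P ⊑ Γ = ∀ v → P v → v ∈ Γ

⊑-bind : {P : Pred (Fin n) Level.zero} {Γ : Subset n} (u : Fin n) →
         (λ v → v ≢ u × P v) ⊑ Γ → P ⊑ Γ [ u ]≔ inside
⊑-bind {Γ = Γ} u h v p with v ≟ u
... | yes refl = []≔-updates Γ u
... | no v≢u   = []≔-minimal Γ v u v≢u (h v (v≢u , p))

names⊑ : {V : Subset n} (ts : Vec (Name V) k) → (Vec∈._∈ Vec.map proj₁ ts) ⊑ V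
names⊑ (t ∷ ts) v (here refl) = proj₂ t
names⊑ (t ∷ ts) v (there i)   = names⊑ ts v i

freeLit⊑ : {τ : Vocabulary} {V : Subset n} (l : Literal τ V) → FreeLit l ⊑ V
freeLit⊑ (t ≈ u)     v (inj₁ refl) = proj₂ t
freeLit⊑ (t ≈ u)     v (inj₂ refl) = proj₂ u
freeLit⊑ (t ≉ u)     v (inj₁ refl) = proj₂ t
freeLit⊑ (t ≉ u)     v (inj₂ refl) = proj₂ u
freeLit⊑ (rel R ts)  v i           = names⊑ ts v i
freeLit⊑ (¬rel R ts) v i           = names⊑ ts v i

freeIF⊑ : {τ : Vocabulary} {V : Subset n} (φ : IF τ V) → FreeIF φ ⊑ V
freeIF⊑ (lit l)               v p             = freeLit⊑ l v p
freeIF⊑ (φ ∧ ψ)               v (inj₁ p)      = freeIF⊑ φ v p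
freeIF⊑ (φ ∧ ψ)               v (inj₂ p)      = freeIF⊑ ψ v p
freeIF⊑ (φ ∨ ψ)               v (inj₁ p)      = freeIF⊑ φ v p
freeIF⊑ (φ ∨ ψ)               v (inj₂ p)      = freeIF⊑ ψ v p
freeIF⊑ (all u φ)             v (_ , p)       = freeIF⊑ φ v p
freeIF⊑ (ex_/⟨_,_⟩ u W W⊆V φ) v (inj₁ p)      = W⊆V p
freeIF⊑ (ex_/⟨_,_⟩ u W W⊆V φ) v (inj₂ (_ , p)) = freeIF⊑ φ v p

------------------------------------------------------------------------
-- Assignments and teams

-- An assignment with domain Γ is a table with one entry per element of Γ,
-- so that _≡_ is extensional equality of assignments.
data Assignment (A : Set ℓ) : Subset n → Set ℓ where
  []   : Assignment A []
  _∷_  : {Γ : Subset n} → A → Assignment A Γ → Assignment A (inside ∷ Γ)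
  skip : {Γ : Subset n} → Assignment A Γ → Assignment A (outside ∷ Γ)

lookup : {A : Set ℓ} {Γ : Subset n} → Assignment A Γ → (v : Fin n) → .(v ∈ Γ) → A
lookup (a ∷ s)  zero    _ = a
lookup (a ∷ s)  (suc v) p = lookup s v (drop-there p)
lookup (skip s) zero    ()
lookup (skip s) (suc v) p = lookup s v (drop-there p)

lookups : {A : Set ℓ} {Γ V : Subset n} → Assignment A Γ → (ts : Vec (Name V) k) →
          .((Vec∈._∈ Vec.map proj₁ ts) ⊑ Γ) → Vec A k
lookups s []       _ = []
lookups s (t ∷ ts) h =
  lookup s (proj₁ t) (h _ (here refl)) ∷ lookups s ts (λ v i → h v (there i))

infixl 6 _[_/_]
_[_/_] : {A : Set ℓ} {Γ : Subset n} →
         Assignment A Γ → A → (v : Fin n) → Assignment A (Γ [ v ]≔ inside)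
(_ ∷ s)  [ a / zero ]  = a ∷ s
(b ∷ s)  [ a / suc v ] = b ∷ (s [ a / v ])
(skip s) [ a / zero ]  = a ∷ s
(skip s) [ a / suc v ] = skip (s [ a / v ])

Team : Set ℓ → Subset n → Set (lsuc ℓ)
Team {ℓ} A Γ = Pred (Assignment A Γ) ℓ

module _ {A : Set ℓ} {Γ : Subset n} where

  -- Functions X → A: the value may not depend on the proof of membership.
  record FunctionOn (X : Team A Γ) : Set ℓ where
    field
      apply      : ∀ s → X s → A
      irrelevant : ∀ s (p q : X s) → apply s p ≡ apply s q

  open FunctionOn public

  supplement : (X : Team A Γ) → FunctionOn X → (v : Fin n) → Team A (Γ [ v ]≔ inside)
  supplement X F v t = ∃[ s ] Σ[ p ∈ X s ] t ≡ s [ apply F s p / v ]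

  duplicate : Team A Γ → (v : Fin n) → Team A (Γ [ v ]≔ inside)
  duplicate X v t = ∃[ s ] X s × ∃[ a ] t ≡ s [ a / v ]

  Independent : Subset n → (X : Team A Γ) → FunctionOn X → Set ℓ
  Independent W X F = ∀ s s' (p : X s) (p' : X s') →
    (∀ v .(v∈Γ : v ∈ Γ) → v ∉ W → lookup s v v∈Γ ≡ lookup s' v v∈Γ) →
    apply F s p ≡ apply F s' p'

------------------------------------------------------------------------
-- Semantics

module _ {τ : Vocabulary} (𝔄 : Structure τ ℓ) {V : Subset n} where

  SatLit : {Γ : Subset n} → Assignment (Carrier 𝔄) Γ →
           (l : Literal τ V) → .(FreeLit l ⊑ Γ) → Set ℓ
  SatLit s (t ≈ u)     h = lookup s (proj₁ t) (h _ (inj₁ refl)) ≡ lookup s (proj₁ u) (h _ (inj₂ refl))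
  SatLit s (t ≉ u)     h = lookup s (proj₁ t) (h _ (inj₁ refl)) ≢ lookup s (proj₁ u) (h _ (inj₂ refl))
  SatLit s (rel R ts)  h = ⟦ 𝔄 ⟧ R (lookups s ts h)
  SatLit s (¬rel R ts) h = ¬ ⟦ 𝔄 ⟧ R (lookups s ts h)

  -- The last argument says that the domain of the team contains the free
  -- variables of the formula; satisfaction does not depend on its value.
  SatIF : {Γ : Subset n} → Team (Carrier 𝔄) Γ →
          (φ : IF τ V) → .(FreeIF φ ⊑ Γ) → Set (lsuc ℓ)
  SatIF X (lit l)   h = Lift (lsuc ℓ) (∀ s → X s → SatLit s l h)
  SatIF X (φ ∧ ψ)   h = SatIF X φ (λ v p → h v (inj₁ p)) × SatIF X ψ (λ v p → h v (inj₂ p))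
  SatIF {Γ} X (φ ∨ ψ) h = Σ[ Y ∈ Team (Carrier 𝔄) Γ ] Σ[ Z ∈ Team (Carrier 𝔄) Γ ]
    X U.≐ (Y U.∪ Z) × SatIF Y φ (λ v p → h v (inj₁ p)) × SatIF Z ψ (λ v p → h v (inj₂ p))
  SatIF X (all (u , _) φ) h = SatIF (duplicate X u) φ (⊑-bind u h)
  SatIF X (ex_/⟨_,_⟩ (u , _) W _ φ) h = Σ[ F ∈ FunctionOn X ]
    Independent W X F × SatIF (supplement X F u) φ (⊑-bind u (λ v p → h v (inj₂ p)))

  SatDL : {Γ : Subset n} → Team (Carrier 𝔄) Γ →
          (φ : DL τ V) → .(FreeDL φ ⊑ Γ) → Set (lsuc ℓ)
  SatDL X (lit l)     h = Lift (lsuc ℓ) (∀ s → X s → SatLit s l h)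
  SatDL X (dep ts t)  h = Lift (lsuc ℓ) (∀ s s' → X s → X s' →
    (∀ v (i : v List∈.∈ List.map proj₁ ts) →
       lookup s v (h v (inj₁ i)) ≡ lookup s' v (h v (inj₁ i))) →
    lookup s (proj₁ t) (h _ (inj₂ refl)) ≡ lookup s' (proj₁ t) (h _ (inj₂ refl)))
  SatDL X (¬dep ts t) h = Lift (lsuc ℓ) (U.Empty X)
  SatDL X (φ ∧ ψ)     h = SatDL X φ (λ v p → h v (inj₁ p)) × SatDL X ψ (λ v p → h v (inj₂ p))
  SatDL {Γ} X (φ ∨ ψ) h = Σ[ Y ∈ Team (Carrier 𝔄) Γ ] Σ[ Z ∈ Team (Carrier 𝔄) Γ ]
    X U.≐ (Y U.∪ Z) × SatDL Y φ (λ v p → h v (inj₁ p)) × SatDL Z ψ (λ v p → h v (inj₂ p))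
  SatDL X (all (u , _) φ) h = SatDL (duplicate X u) φ (⊑-bind u h)
  SatDL X (ex (u , _) φ)  h = Σ[ F ∈ FunctionOn X ] SatDL (supplement X F u) φ (⊑-bind u h)

{-# OPTIONS --safe #-}
module Submission where

-- Every IF² formula φ over x, y is translated to a formula φ ^ over x, y, z
-- whose truth in a team P depends only on the projection of P to {x , y}.
-- Precisely, if X is the projection of P, then X satisfies φ iff P satisfies
-- φ ^ (the lemma `correct`).  The translation commutes with literals,
-- connectives and ∀.  A slashed quantifier ∃u/W φ becomes
--
--   ∃z (z = u ∧ ∃u (=(t₁,…,tₘ,u) ∧ φ ^)),
--
-- where t₁,…,tₘ are the variables among x, y outside W, with u itself
-- replaced by z: since ∃u overwrites u, its old value is first saved in z.
-- The dependence atom then says exactly that the choice of u is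
-- W-independent.  An unslashed ∃u is the case of empty W.
--
-- The quantifier step needs the choice functions for X and for P to
-- correspond.  In general, obtaining a function on X from one on P would
-- require choosing a preimage for each assignment in X.  Resetting z to u
-- avoids this: on a team satisfying z = u, the projection is injective
-- (`tagged-injective`), so functions can be moved in both directions (`pull`
-- and `push`).
--
-- A team X over {x , y} is the projection of X(A/z), so ∀z (φ ^) is
-- equivalent to φ, and its free variables are among x and y.

open import Data.Bool using (if_then_else_)
open import Data.Empty using (⊥-elim)
open import Data.Fin using (Fin; zero; suc; _≟_)
open import Data.Fin.Subset using (Subset; Side; inside; _∈_; _∉_)
open import Data.Fin.Subset.Properties using (∈⊤; _∈?_)
open import Data.List using (List; []; _∷_; map; filter)
import Data.List.Membership.Propositional as List∈
open import Data.List.Membership.Propositional.Properties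
  using (∈-map⁺; ∈-map⁻; ∈-filter⁺; ∈-filter⁻)
open import Data.List.Relation.Unary.Any using (here; there)
open import Data.Product using (Σ-syntax; ∃-syntax; _×_; _,_; proj₁; proj₂)
import Data.Sum as Sum
open import Data.Sum using (inj₁; inj₂)
open import Data.Vec using (Vec; []; _∷_; here; there)
import Data.Vec as Vec
open import Function using (_∘_; id)
open import Function.Bundles using (_⇔_; mk⇔; Equivalence)
open import Level using (Level; Lift; lift) renaming (suc to lsuc)
open import Relation.Binary.PropositionalEquality
  using (_≡_; refl; sym; trans; cong; cong₂; subst; module ≡-Reasoning)
open import Relation.Nullary using (does; ¬?; recompute)
import Relation.Unary as U
open U using (Decidable)
open import Defs

open Equivalence using (to; from)

private variable
  ℓ : Level
  A : Set ℓ
  b : Side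
  τ : Vocabulary

pattern x = zero
pattern y = suc zero
pattern z = suc (suc zero)

------------------------------------------------------------------------
-- Translation

widen : Name ⟨x,y⟩ → Name ⟨x,y,z⟩
widen (v , _) = v , ∈⊤

widenLit : Literal τ ⟨x,y⟩ → Literal τ ⟨x,y,z⟩
widenLit (t ≈ u)     = widen t ≈ widen u
widenLit (t ≉ u)     = widen t ≉ widen u
widenLit (rel R ts)  = rel R (Vec.map widen ts)
widenLit (¬rel R ts) = ¬rel R (Vec.map widen ts)

names : List (Name ⟨x,y⟩)
names = (x , here) ∷ (y , there here) ∷ []

-- Where the old value of w is found once u has been saved in z and then
-- overwritten.
source : Name ⟨x,y⟩ → Name ⟨x,y⟩ → Name ⟨x,y,z⟩
source u w = if does (proj₁ u ≟ proj₁ w) then (z , ∈⊤) else widen w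

outside? : (W : Subset 3) → Decidable (λ (w : Name ⟨x,y⟩) → proj₁ w ∉ W)
outside? W w = ¬? (proj₁ w ∈? W)

-- The locations of the old values of the variables outside W.
sources : Name ⟨x,y⟩ → Subset 3 → List (Name ⟨x,y,z⟩)
sources u W = map (source u) (filter (outside? W) names)

-- The translation.  Its truth in a team over {x , y , z} does not depend on
-- the values of z.
infix 25 _^
_^ : IF² τ → D³ τ
lit l ^                = lit (widenLit l)
(φ ∧ ψ) ^              = φ ^ ∧ ψ ^
(φ ∨ ψ) ^              = φ ^ ∨ ψ ^
all u φ ^              = all (widen u) (φ ^)
(ex u /⟨ W , _ ⟩ φ) ^  =
  ex (z , ∈⊤) (lit ((z , ∈⊤) ≈ widen u) ∧
    ex (widen u) (dep (sources u W) (widen u) ∧ φ ^))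

------------------------------------------------------------------------
-- Assignments

-- Restriction to {x , y}.
forget : Assignment A ⟨x,y,z⟩ → Assignment A ⟨x,y⟩
forget (a ∷ b ∷ c ∷ []) = a ∷ b ∷ skip []

-- Updating x or y in an assignment whose domain already contains both.  For
-- concrete u this is s [ a / u ]; for arbitrary u it avoids the domain
-- ⟨x,y⟩ [ u ]≔ inside, which is then not definitionally ⟨x,y⟩.
set : Name ⟨x,y⟩ → Assignment A (inside ∷ inside ∷ b ∷ []) → A →
      Assignment A (inside ∷ inside ∷ b ∷ [])
set (x , _) s a = s [ a / x ]
set (y , _) s a = s [ a / y ]
set (z , there (there ()))

-- The value of z is a copy of the value of u.
Tagged : Name ⟨x,y⟩ → Assignment A ⟨x,y,z⟩ → Set _
Tagged u t = lookup t z ∈⊤ ≡ lookup t (proj₁ u) ∈⊤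

lookup-forget : (t : Assignment A ⟨x,y,z⟩) (w : Name ⟨x,y⟩) →
  lookup (forget t) (proj₁ w) (proj₂ w) ≡ lookup t (proj₁ w) ∈⊤
lookup-forget (a ∷ b ∷ c ∷ []) (x , _) = refl
lookup-forget (a ∷ b ∷ c ∷ []) (y , _) = refl
lookup-forget _ (z , there (there ()))

forget-set : (u : Name ⟨x,y⟩) (t : Assignment A ⟨x,y,z⟩) (a : A) →
  forget (set u t a) ≡ set u (forget t) a
forget-set (x , _) (_ ∷ _ ∷ _ ∷ []) a = refl
forget-set (y , _) (_ ∷ _ ∷ _ ∷ []) a = refl
forget-set (z , there (there ()))

forget-z : (t : Assignment A ⟨x,y,z⟩) (c : A) → forget (t [ c / z ]) ≡ forget t
forget-z (_ ∷ _ ∷ _ ∷ []) c = refl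

forget-extend : (s : Assignment A ⟨x,y⟩) (c : A) → forget (s [ c / z ]) ≡ s
forget-extend (_ ∷ _ ∷ skip []) c = refl

lookup-set : (u : Name ⟨x,y⟩) (t : Assignment A ⟨x,y,z⟩) (a : A) →
  lookup (set u t a) (proj₁ u) ∈⊤ ≡ a
lookup-set (x , _) (_ ∷ _ ∷ _ ∷ []) a = refl
lookup-set (y , _) (_ ∷ _ ∷ _ ∷ []) a = refl
lookup-set (z , there (there ()))

tag : (u : Name ⟨x,y⟩) (t : Assignment A ⟨x,y,z⟩) →
  Tagged u (t [ lookup t (proj₁ u) ∈⊤ / z ])
tag (x , _) (_ ∷ _ ∷ _ ∷ []) = refl
tag (y , _) (_ ∷ _ ∷ _ ∷ []) = refl
tag (z , there (there ()))

forget-z-injective : (t t' : Assignment A ⟨x,y,z⟩) → forget t ≡ forget t' →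
  lookup t z ∈⊤ ≡ lookup t' z ∈⊤ → t ≡ t'
forget-z-injective (_ ∷ _ ∷ _ ∷ []) (_ ∷ _ ∷ _ ∷ []) refl refl = refl

tagged-injective : (u : Name ⟨x,y⟩) {t t' : Assignment A ⟨x,y,z⟩} →
  Tagged u t → Tagged u t' → forget t ≡ forget t' → t ≡ t'
tagged-injective u {t} {t'} g g' e = forget-z-injective t t' e (begin
  lookup t z ∈⊤                             ≡⟨ g ⟩
  lookup t (proj₁ u) ∈⊤                     ≡⟨ lookup-forget t u ⟨
  lookup (forget t) (proj₁ u) (proj₂ u)     ≡⟨ cong (λ s → lookup s (proj₁ u) (proj₂ u)) e ⟩
  lookup (forget t') (proj₁ u) (proj₂ u)    ≡⟨ lookup-forget t' u ⟩
  lookup t' (proj₁ u) ∈⊤                    ≡⟨ g' ⟨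
  lookup t' z ∈⊤                            ∎)
  where open ≡-Reasoning

lookup-source : (u w : Name ⟨x,y⟩) (t : Assignment A ⟨x,y,z⟩) (a : A) → Tagged u t →
  lookup (set u t a) (proj₁ (source u w)) ∈⊤ ≡ lookup (forget t) (proj₁ w) (proj₂ w)
lookup-source (x , _) (x , _) (_ ∷ _ ∷ _ ∷ []) a g = g
lookup-source (x , _) (y , _) (_ ∷ _ ∷ _ ∷ []) a g = refl
lookup-source (y , _) (x , _) (_ ∷ _ ∷ _ ∷ []) a g = refl
lookup-source (y , _) (y , _) (_ ∷ _ ∷ _ ∷ []) a g = g
lookup-source (z , there (there ()))
lookup-source _ (z , there (there ()))

------------------------------------------------------------------------
-- Agreement outside a slash set

∈-names : (w : Name ⟨x,y⟩) → w List∈.∈ names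
∈-names (x , here)       = here refl
∈-names (y , there here) = there (here refl)
∈-names (z , there (there ()))

∈-sources⁺ : (u w : Name ⟨x,y⟩) {W : Subset 3} → proj₁ w ∉ W →
  proj₁ (source u w) List∈.∈ map proj₁ (sources u W)
∈-sources⁺ u w {W} w∉W =
  ∈-map⁺ proj₁ (∈-map⁺ (source u) (∈-filter⁺ (outside? W) (∈-names w) w∉W))

∈-sources⁻ : (u : Name ⟨x,y⟩) {W : Subset 3} {v : Fin 3} →
  v List∈.∈ map proj₁ (sources u W) →
  ∃[ w ] proj₁ w ∉ W × v ≡ proj₁ (source u w)
∈-sources⁻ u {W} i with ∈-map⁻ proj₁ i
... | _ , j , refl with ∈-map⁻ (source u) j
...   | w , k , refl =
        w , proj₂ (∈-filter⁻ (outside? W) {xs = names} k) , refl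

-- Agreement on all variables in vs: for vs = sources u W, the hypothesis
-- of the dependence atom in the translation.
AgreeAt : List (Name ⟨x,y,z⟩) → (t t' : Assignment A ⟨x,y,z⟩) → Set _
AgreeAt vs t t' = ∀ v → v List∈.∈ map proj₁ vs → lookup t v ∈⊤ ≡ lookup t' v ∈⊤

-- The hypothesis of W-independence.
AgreeOff : Subset 3 → (s s' : Assignment A ⟨x,y⟩) → Set _
AgreeOff W s s' = ∀ v .(v∈ : v ∈ ⟨x,y⟩) → v ∉ W → lookup s v v∈ ≡ lookup s' v v∈

-- What the dependence atom in the translation says of a team.
Depends : Name ⟨x,y⟩ → Subset 3 → Team A ⟨x,y,z⟩ → Set _
Depends u W T = ∀ t t' → T t → T t' → AgreeAt (sources u W) t t' →
  lookup t (proj₁ u) ∈⊤ ≡ lookup t' (proj₁ u) ∈⊤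

module _ (u : Name ⟨x,y⟩) {W : Subset 3} {t t' : Assignment A ⟨x,y,z⟩} (a a' : A)
         (g : Tagged u t) (g' : Tagged u t') where

  agreeAt⇒agreeOff : AgreeAt (sources u W) (set u t a) (set u t' a') →
                     AgreeOff W (forget t) (forget t')
  agreeAt⇒agreeOff agree v v∈ v∉W =
    trans (sym (lookup-source u w t a g))
      (trans (agree _ (∈-sources⁺ u w v∉W)) (lookup-source u w t' a' g'))
    where w = v , recompute (v ∈? ⟨x,y⟩) v∈

  agreeOff⇒agreeAt : AgreeOff W (forget t) (forget t') →
                     AgreeAt (sources u W) (set u t a) (set u t' a')
  agreeOff⇒agreeAt agree v i with ∈-sources⁻ u i
  ... | w , w∉W , refl =
    trans (lookup-source u w t a g)
      (trans (agree _ (proj₂ w) w∉W) (sym (lookup-source u w t' a' g')))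

------------------------------------------------------------------------
-- Projections of teams

-- X is the projection of P to {x , y}.
Projection : Team A ⟨x,y⟩ → Team A ⟨x,y,z⟩ → Set _
Projection X P = X U.≐ λ s → ∃[ t ] P t × s ≡ forget t

-- For concrete u, these are duplicate and supplement up to definitional
-- equality, without a change of domain in their types.
duplicateAt : Name ⟨x,y⟩ → Team A (inside ∷ inside ∷ b ∷ []) →
              Team A (inside ∷ inside ∷ b ∷ [])
duplicateAt u X t = ∃[ s ] X s × ∃[ a ] t ≡ set u s a

supplementAt : (u : Name ⟨x,y⟩) (X : Team A (inside ∷ inside ∷ b ∷ [])) →
               FunctionOn X → Team A (inside ∷ inside ∷ b ∷ [])
supplementAt u X F t = ∃[ s ] Σ[ p ∈ X s ] t ≡ set u s (apply F s p)

apply-cong : {X : Team A ⟨x,y,z⟩} (F : FunctionOn X) {t t' : Assignment A ⟨x,y,z⟩} →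
  t ≡ t' → (p : X t) (p' : X t') → apply F t p ≡ apply F t' p'
apply-cong F refl = irrelevant F _

module _ {X : Team A ⟨x,y⟩} {P : Team A ⟨x,y,z⟩} (π : Projection X P) where

  forget-∈ : ∀ {t} → P t → X (forget t)
  forget-∈ p = proj₂ π (_ , p , refl)

  projection-duplicate : (u : Name ⟨x,y⟩) →
    Projection (duplicateAt u X) (duplicateAt u P)
  projection-duplicate u = ⊆ , ⊇
    where
    ⊆ : ∀ {s} → duplicateAt u X s → ∃[ t ] duplicateAt u P t × s ≡ forget t
    ⊆ (s , p , a , refl) with proj₁ π p
    ... | t , q , refl = set u t a , (t , q , a , refl) , sym (forget-set u t a)
    ⊇ : ∀ {s} → ∃[ t ] duplicateAt u P t × s ≡ forget t → duplicateAt u X s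
    ⊇ (_ , (t , q , a , refl) , refl) = forget t , forget-∈ q , a , forget-set u t a

  projection-supplement-z : (G : FunctionOn P) → Projection X (supplement P G z)
  projection-supplement-z G = ⊆ , ⊇
    where
    ⊆ : ∀ {s} → X s → ∃[ t ] supplement P G z t × s ≡ forget t
    ⊆ p with proj₁ π p
    ... | t , q , refl = _ , (t , q , refl) , sym (forget-z t _)
    ⊇ : ∀ {s} → ∃[ t ] supplement P G z t × s ≡ forget t → X s
    ⊇ (_ , (t , q , refl) , refl) = subst X (sym (forget-z t _)) (forget-∈ q)

  projection-∩ : {Y : Team A ⟨x,y⟩} → Y U.⊆ X → Projection Y (P U.∩ (Y ∘ forget))
  projection-∩ {Y} Y⊆X = ⊆ , λ { (_ , (_ , r) , refl) → r }
    where
    ⊆ : ∀ {s} → Y s → ∃[ t ] (P U.∩ (Y ∘ forget)) t × s ≡ forget t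
    ⊆ r with proj₁ π (Y⊆X r)
    ... | t , q , refl = t , (q , r) , refl

projection-duplicate-z : (X : Team A ⟨x,y⟩) → Projection X (duplicate X z)
projection-duplicate-z X = ⊆ , ⊇
  where
  -- A value for z has to exist; as the domain of s is nonempty, that of x
  -- will do.
  ⊆ : ∀ {s} → X s → ∃[ t ] duplicate X z t × s ≡ forget t
  ⊆ {s} p = _ , (s , p , lookup s x here , refl) , sym (forget-extend s _)
  ⊇ : ∀ {s} → ∃[ t ] duplicate X z t × s ≡ forget t → X s
  ⊇ (_ , (s , p , c , refl) , refl) = subst X (sym (forget-extend s c)) p

------------------------------------------------------------------------
-- Moving choice functions along an injective projection

module Choice (u : Name ⟨x,y⟩) {X : Team A ⟨x,y⟩} {Q : Team A ⟨x,y,z⟩}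
              (π : Projection X Q) (tagged : ∀ t → Q t → Tagged u t) where

  pull : FunctionOn X → FunctionOn Q
  pull F = record
    { apply      = λ t q → apply F (forget t) (forget-∈ π q)
    ; irrelevant = λ t q q' → irrelevant F (forget t) _ _ }

  projection-pull : (F : FunctionOn X) →
    Projection (supplementAt u X F) (supplementAt u Q (pull F))
  projection-pull F = ⊆ , ⊇
    where
    ⊆ : ∀ {s} → supplementAt u X F s →
        ∃[ t ] supplementAt u Q (pull F) t × s ≡ forget t
    ⊆ (s , p , refl) with proj₁ π p
    ... | t , q , refl = _ , (t , q , refl) ,
      trans (cong (set u (forget t)) (irrelevant F _ _ _)) (sym (forget-set u t _))
    ⊇ : ∀ {s} → ∃[ t ] supplementAt u Q (pull F) t × s ≡ forget t →
        supplementAt u X F s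
    ⊇ (_ , (t , q , refl) , refl) = forget t , forget-∈ π q , forget-set u t _

  pull-depends : {W : Subset 3} (F : FunctionOn X) → Independent W X F →
    Depends u W (supplementAt u Q (pull F))
  pull-depends F ind _ _ (t , q , refl) (t' , q' , refl) agree =
    trans (lookup-set u t _)
      (trans (ind _ _ _ _ (agreeAt⇒agreeOff u _ _ (tagged t q) (tagged t' q') agree))
             (sym (lookup-set u t' _)))

  -- The value at a preimage, which is unique because Q is tagged.
  push : FunctionOn Q → FunctionOn X
  push H = record { apply = value ; irrelevant = unique }
    where
    value : ∀ s → X s → _
    value s p with proj₁ π p
    ... | t , q , _ = apply H t q
    unique : ∀ s (p p' : X s) → value s p ≡ value s p'
    unique s p p' with proj₁ π p | proj₁ π p'
    ... | t , q , e | t' , q' , e' = apply-cong H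
      (tagged-injective u (tagged t q) (tagged t' q') (trans (sym e) e')) q q'

  push-forget : (H : FunctionOn Q) → ∀ t (q : Q t) (p : X (forget t)) →
    apply (push H) (forget t) p ≡ apply H t q
  push-forget H t q p with proj₁ π p
  ... | t' , q' , e = apply-cong H
    (tagged-injective u (tagged t' q') (tagged t q) (sym e)) q' q

  projection-push : (H : FunctionOn Q) →
    Projection (supplementAt u X (push H)) (supplementAt u Q H)
  projection-push H = ⊆ , ⊇
    where
    ⊆ : ∀ {s} → supplementAt u X (push H) s →
        ∃[ t ] supplementAt u Q H t × s ≡ forget t
    ⊆ (s , p , refl) with proj₁ π p
    ... | t , q , refl = _ , (t , q , refl) , sym (forget-set u t _)
    ⊇ : ∀ {s} → ∃[ t ] supplementAt u Q H t × s ≡ forget t →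
        supplementAt u X (push H) s
    ⊇ (_ , (t , q , refl) , refl) = forget t , forget-∈ π q ,
      trans (forget-set u t _)
            (cong (set u (forget t)) (sym (push-forget H t q _)))

  push-independent : {W : Subset 3} (H : FunctionOn Q) →
    Depends u W (supplementAt u Q H) → Independent W X (push H)
  push-independent H depends s s' p p' agree with proj₁ π p | proj₁ π p'
  ... | t , q , refl | t' , q' , refl =
    trans (sym (lookup-set u t _))
      (trans (depends _ _ (t , q , refl) (t' , q' , refl)
               (agreeOff⇒agreeAt u _ _ (tagged t q) (tagged t' q') agree))
             (lookup-set u t' _))

-- The slashed quantifier and its translation are equivalent over any two
-- team properties S and T that correspond under projection; in the
-- application these are satisfaction of φ and of φ ^.
∃/⇔save-∃-dep : {A : Set ℓ} (u : Name ⟨x,y⟩) (W : Subset 3)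
  {S : Team A ⟨x,y⟩ → Set (lsuc ℓ)} {T : Team A ⟨x,y,z⟩ → Set (lsuc ℓ)} →
  (∀ {X P} → Projection X P → S X ⇔ T P) →
  ∀ {X P} → Projection X P →
  (Σ[ F ∈ FunctionOn X ] Independent W X F × S (supplementAt u X F)) ⇔
  (Σ[ G ∈ FunctionOn P ] Lift (lsuc ℓ) (∀ t → supplement P G z t → Tagged u t) ×
   Σ[ H ∈ FunctionOn (supplement P G z) ]
     Lift (lsuc ℓ) (Depends u W (supplementAt u (supplement P G z) H)) ×
     T (supplementAt u (supplement P G z) H))
∃/⇔save-∃-dep u W S⇔T {P = P} π = mk⇔
  (λ (F , ind , sat) →
    let open Choice u (projection-supplement-z π save) save-tagged in
    save , lift save-tagged , pull F , lift (pull-depends F ind) ,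
    to (S⇔T (projection-pull F)) sat)
  (λ (G , lift tagged , H , lift depends , sat) →
    let open Choice u (projection-supplement-z π G) tagged in
    push H , push-independent H depends ,
    from (S⇔T (projection-push H)) sat)
  where
  save : FunctionOn P
  save = record { apply      = λ t _ → lookup t (proj₁ u) ∈⊤
                ; irrelevant = λ _ _ _ → refl }

  save-tagged : ∀ t → supplement P save z t → Tagged u t
  save-tagged _ (t , _ , refl) = tag u t

------------------------------------------------------------------------
-- Correctness

lookups-widen : ∀ {k} (t : Assignment A ⟨x,y,z⟩) (ts : Vec (Name ⟨x,y⟩) k) →
  lookups (forget t) ts (names⊑ ts) ≡ lookups t (Vec.map widen ts) (λ _ _ → ∈⊤)
lookups-widen t []       = refl
lookups-widen t (w ∷ ts) = cong₂ _∷_ (lookup-forget t w) (lookups-widen t ts)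

module _ {τ : Vocabulary} (𝔄 : Structure τ ℓ) where

  satLit-widen : (l : Literal τ ⟨x,y⟩) (t : Assignment (Carrier 𝔄) ⟨x,y,z⟩) →
    SatLit 𝔄 (forget t) l (freeLit⊑ l) ≡ SatLit 𝔄 t (widenLit l) (λ _ _ → ∈⊤)
  satLit-widen (v ≈ w)     t = cong₂ _≡_ (lookup-forget t v) (lookup-forget t w)
  satLit-widen (v ≉ w)     t = cong₂ (λ a b → a ≡ b → _) (lookup-forget t v) (lookup-forget t w)
  satLit-widen (rel R ts)  t = cong (⟦ 𝔄 ⟧ R) (lookups-widen t ts)
  satLit-widen (¬rel R ts) t = cong (λ as → ⟦ 𝔄 ⟧ R as → _) (lookups-widen t ts)

  -- The quantifier cases split on u because the domains of the duplicated
  -- and supplemented teams compute only for a concrete variable.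
  correct : (φ : IF² τ) {X : Team (Carrier 𝔄) ⟨x,y⟩} {P : Team (Carrier 𝔄) ⟨x,y,z⟩} →
    Projection X P → SatIF 𝔄 X φ (freeIF⊑ φ) ⇔ SatDL 𝔄 P (φ ^) (λ _ _ → ∈⊤)
  correct (lit l) π = mk⇔
    (λ (lift sat) → lift λ t p → subst id (satLit-widen l t) (sat _ (forget-∈ π p)))
    (λ (lift sat) → lift λ s p → back sat (proj₁ π p))
    where
    back : ∀ {P : Team (Carrier 𝔄) ⟨x,y,z⟩} {s} →
      (∀ t → P t → SatLit 𝔄 t (widenLit l) (λ _ _ → ∈⊤)) →
      ∃[ t ] P t × s ≡ forget t → SatLit 𝔄 s l (freeLit⊑ l)
    back sat (t , q , refl) = subst id (sym (satLit-widen l t)) (sat t q)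
  correct (φ ∧ ψ) π = mk⇔
    (λ (p , q) → to (correct φ π) p , to (correct ψ π) q)
    (λ (p , q) → from (correct φ π) p , from (correct ψ π) q)
  correct (φ ∨ ψ) {X} {P} π = mk⇔
    -- P is split into the preimages of Y and Z under forget.
    (λ (Y , Z , (X⊆ , ⊆X) , p , q) →
      _ , _ ,
      ( (λ r → Sum.map (r ,_) (r ,_) (X⊆ (forget-∈ π r)))
      , Sum.[ proj₁ , proj₁ ]) ,
      to (correct φ (projection-∩ π (λ r → ⊆X (inj₁ r)))) p ,
      to (correct ψ (projection-∩ π (λ r → ⊆X (inj₂ r)))) q)
    -- X is split into the projections of Y and Z.
    (λ (Y , Z , (P⊆ , ⊆P) , p , q) →
      _ , _ ,
      ( (λ r → let (t , r' , e) = proj₁ π r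
               in Sum.map (λ i → t , i , e) (λ i → t , i , e) (P⊆ r'))
      , λ { (inj₁ (t , i , e)) → proj₂ π (t , ⊆P (inj₁ i) , e)
          ; (inj₂ (t , i , e)) → proj₂ π (t , ⊆P (inj₂ i) , e) }) ,
      from (correct φ (id , id)) p ,
      from (correct ψ (id , id)) q)
  correct (all u@(x , _) φ) π = mk⇔ (to ih) (from ih)
    where ih = correct φ (projection-duplicate π u)
  correct (all u@(y , _) φ) π = mk⇔ (to ih) (from ih)
    where ih = correct φ (projection-duplicate π u)
  correct (all (z , there (there ())) φ)
  correct (ex u@(x , _) /⟨ W , _ ⟩ φ) π = mk⇔ (to step) (from step)
    where step = ∃/⇔save-∃-dep u W (correct φ) π
  correct (ex u@(y , _) /⟨ W , _ ⟩ φ) π = mk⇔ (to step) (from step)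
    where step = ∃/⇔save-∃-dep u W (correct φ) π
  correct (ex (z , there (there ())) /⟨ _ , _ ⟩ φ)

lemma3p2 : ∀ {ℓ} (τ : Vocabulary) → AtMostBinary τ → (φ : IF² τ) →
    Σ[ φ* ∈ D³ τ ] Σ[ fr ∈ FreeDL φ* ⊑ ⟨x,y⟩ ]
    ∀ (𝔄 : Structure τ ℓ) (X : Team (Carrier 𝔄) ⟨x,y⟩) →
    SatIF 𝔄 X φ (freeIF⊑ φ) ⇔ SatDL 𝔄 X φ* fr
lemma3p2 τ _ φ = all (z , ∈⊤) (φ ^) , free ,
  λ 𝔄 X → let ih = correct 𝔄 φ (projection-duplicate-z X) in mk⇔ (to ih) (from ih)
  where
  free : FreeDL (all (z , ∈⊤) (φ ^)) ⊑ ⟨x,y⟩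
  free x _         = here
  free y _         = there here
  free z (z≢z , _) = ⊥-elim (z≢z refl)
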